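{- The sequent calculi $\mathbf{S4}$ and $\mathbf{GL}$ have monotone feasible $\mathrm{MDIP}$: for $G\in\{\mathbf{S4},\mathbf{GL}\}$ with logic $L\in\{\mathsf{S4},\mathsf{GL}\}$ respectively, there is a polynomial $p$ such that for any $G$-proof $u$ of a formula $\phi\to\Box\psi\vee\Box\theta$ with $\phi$ monotone, with code $w$, there are monotone $\mathcal{L}_\Box$-circuits $C$ and $D$ of size at most $p(|u|,|w|)$ such that $([C],[D])$ is an $L$-MDI for $\phi\to\Box\psi\vee\Box\theta$.
   Context: Modal formulas ($\mathcal{L}_\Box$) are over $\{\top,\bot,\wedge,\vee,\to,\Box\}$; monotone means containing no implication. $\mathbf{S4}$ is the classical sequent calculus $\mathbf{LK}$ (with cut) over $\mathcal{L}_\Box$ extended by the rules: from $\Gamma,\phi\Rightarrow\Delta$ infer $\Gamma,\Box\phi\Rightarrow\Delta$; and from $\Box\Gamma\Rightarrow\phi$ infer $\Box\Gamma\Rightarrow\Box\phi$. $\mathbf{GL}$ is $\mathbf{LK}$ extended by the rule: from $\Box\Gamma,\Gamma,\Box\phi\Rightarrow\phi$ infer $\Box\Gamma\Rightarrow\Box\phi$. A $G$-proof of a formula $\chi$ is a proof of $\Rightarrow\chi$; $\mathsf{S4}$, $\mathsf{GL}$ are the sets of formulas so provable. Monotone $\mathcal{L}_\Box$-circuits have gates among $\top,\bot,\wedge,\vee,\Box$; $[C]$ is the unfolded formula. An $L$-MDI for $(\phi\to\Box\psi\vee\Box\theta)\in L$ is a pair $(I,J)$ with atoms among those of $\phi$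 such that $\phi\to I\vee J$, $I\to\Box\psi$, $J\to\Box\theta$ are in $L$. -}

module Defs where

open import Data.Nat using (ℕ; zero; suc; _+_; _*_)
open import Data.Fin using (Fin)
open import Data.List using (List; []; _∷_; _++_; map; [_])
open import Data.List.Membership.Propositional using (_∈_)
open import Data.List.Relation.Unary.All using (All)
open import Data.Product using (Σ; _×_)
open import Data.Vec using (Vec; lookup) renaming ([] to []v; _∷_ to _∷v_)

infixr 30 □_
infixr 25 _∧_
infixr 24 _∨_
infixr 22 _⇒_
infix 4 _⊢_

data Fm : Set where
  var : ℕ → Fm
  top bot : Fm
  _∧_ _∨_ _⇒_ : Fm → Fm → Fm
  □_ : Fm → Fm

data Monotone : Fm → Set where
  mvar : ∀ a → Monotone (var a)
  mtop : Monotone top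
  mbot : Monotone bot
  mand : ∀ {φ ψ} → Monotone φ → Monotone ψ → Monotone (φ ∧ ψ)
  mor  : ∀ {φ ψ} → Monotone φ → Monotone ψ → Monotone (φ ∨ ψ)
  mbox : ∀ {φ} → Monotone φ → Monotone (□ φ)

atoms : Fm → List ℕ
atoms (var a) = a ∷ []
atoms top = []
atoms bot = []
atoms (φ ∧ ψ) = atoms φ ++ atoms ψ
atoms (φ ∨ ψ) = atoms φ ++ atoms ψ
atoms (φ ⇒ ψ) = atoms φ ++ atoms ψ
atoms (□ φ) = atoms φ

fsize : Fm → ℕ
fsize (var a) = 1
fsize top = 1
fsize bot = 1
fsize (φ ∧ ψ) = suc (fsize φ + fsize ψ)
fsize (φ ∨ ψ) = suc (fsize φ + fsize ψ)
fsize (φ ⇒ ψ) = suc (fsize φ + fsize ψ)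
fsize (□ φ) = suc (fsize φ)

record Sequent : Set where
  constructor _⊢_
  field
    ante : List Fm
    succ : List Fm

lsize : List Fm → ℕ
lsize [] = 0
lsize (φ ∷ Γ) = fsize φ + lsize Γ

ssize : Sequent → ℕ
ssize (Γ ⊢ Δ) = suc (lsize Γ + lsize Δ)

□* : List Fm → List Fm
□* = map □_

data LKRule : List Sequent → Sequent → Set where
  ax   : ∀ φ → LKRule [] (φ ∷ [] ⊢ φ ∷ [])
  topR : LKRule [] ([] ⊢ top ∷ [])
  botL : LKRule [] (bot ∷ [] ⊢ [])
  wL   : ∀ {Γ Δ} φ → LKRule [ (Γ ⊢ Δ) ] (φ ∷ Γ ⊢ Δ)
  wR   : ∀ {Γ Δ} φ → LKRule [ (Γ ⊢ Δ) ] (Γ ⊢ φ ∷ Δ)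
  cL   : ∀ {Γ Δ} φ → LKRule [ (φ ∷ φ ∷ Γ ⊢ Δ) ] (φ ∷ Γ ⊢ Δ)
  cR   : ∀ {Γ Δ} φ → LKRule [ (Γ ⊢ φ ∷ φ ∷ Δ) ] (Γ ⊢ φ ∷ Δ)
  exL  : ∀ Γ₁ {Γ₂ Δ} φ ψ → LKRule [ (Γ₁ ++ φ ∷ ψ ∷ Γ₂ ⊢ Δ) ] (Γ₁ ++ ψ ∷ φ ∷ Γ₂ ⊢ Δ)
  exR  : ∀ {Γ} Δ₁ {Δ₂} φ ψ → LKRule [ (Γ ⊢ Δ₁ ++ φ ∷ ψ ∷ Δ₂) ] (Γ ⊢ Δ₁ ++ ψ ∷ φ ∷ Δ₂)
  cut  : ∀ {Γ Δ Γ' Δ'} φ → LKRule ((Γ ⊢ φ ∷ Δ) ∷ (φ ∷ Γ' ⊢ Δ') ∷ []) (Γ ++ Γ' ⊢ Δ ++ Δ')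
  andL₁ : ∀ {Γ Δ} φ ψ → LKRule [ (φ ∷ Γ ⊢ Δ) ] (φ ∧ ψ ∷ Γ ⊢ Δ)
  andL₂ : ∀ {Γ Δ} φ ψ → LKRule [ (ψ ∷ Γ ⊢ Δ) ] (φ ∧ ψ ∷ Γ ⊢ Δ)
  andR  : ∀ {Γ Δ} φ ψ → LKRule ((Γ ⊢ φ ∷ Δ) ∷ (Γ ⊢ ψ ∷ Δ) ∷ []) (Γ ⊢ φ ∧ ψ ∷ Δ)
  orL   : ∀ {Γ Δ} φ ψ → LKRule ((φ ∷ Γ ⊢ Δ) ∷ (ψ ∷ Γ ⊢ Δ) ∷ []) (φ ∨ ψ ∷ Γ ⊢ Δ)
  orR₁  : ∀ {Γ Δ} φ ψ → LKRule [ (Γ ⊢ φ ∷ Δ) ] (Γ ⊢ φ ∨ ψ ∷ Δ)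
  orR₂  : ∀ {Γ Δ} φ ψ → LKRule [ (Γ ⊢ ψ ∷ Δ) ] (Γ ⊢ φ ∨ ψ ∷ Δ)
  impL  : ∀ {Γ Δ} φ ψ → LKRule ((Γ ⊢ φ ∷ Δ) ∷ (ψ ∷ Γ ⊢ Δ) ∷ []) (φ ⇒ ψ ∷ Γ ⊢ Δ)
  impR  : ∀ {Γ Δ} φ ψ → LKRule [ (φ ∷ Γ ⊢ ψ ∷ Δ) ] (Γ ⊢ φ ⇒ ψ ∷ Δ)

data System : Set where
  S4 GL : System

data ModalRule : System → List Sequent → Sequent → Set where
  boxL-S4 : ∀ {Γ Δ} φ → ModalRule S4 [ (φ ∷ Γ ⊢ Δ) ] (□ φ ∷ Γ ⊢ Δ)
  boxR-S4 : ∀ Γ φ → ModalRule S4 [ (□* Γ ⊢ φ ∷ []) ] (□* Γ ⊢ □ φ ∷ [])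
  boxR-GL : ∀ Γ φ → ModalRule GL [ (□* Γ ++ Γ ++ (□ φ ∷ []) ⊢ φ ∷ []) ] (□* Γ ⊢ □ φ ∷ [])

data Rule (G : System) (ps : List Sequent) (s : Sequent) : Set where
  lk    : LKRule ps s → Rule G ps s
  modal : ModalRule G ps s → Rule G ps s

-- A (dag-like) proof: a sequence of sequents, each obtained by a rule
-- from premises occurring earlier.  The list is stored newest-first.
data Lines (G : System) : List Sequent → Set where
  []    : Lines G []
  step  : ∀ {ss} (s : Sequent) (ps : List Sequent) →
          Rule G ps s → All (_∈ ss) ps → Lines G ss → Lines G (s ∷ ss)

record GProof (G : System) (χ : Fm) : Set where
  constructor proof
  field
    earlier : List Sequent
    lines   : Lines G (([] ⊢ χ ∷ []) ∷ earlier)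

psize : ∀ {G χ} → GProof G χ → ℕ
psize {χ = χ} (proof earlier _) = go (([] ⊢ χ ∷ []) ∷ earlier)
  where
  go : List Sequent → ℕ
  go [] = 0
  go (s ∷ ss) = ssize s + go ss

Thm : System → Fm → Set
Thm G χ = GProof G χ

data Gate (n : ℕ) : Set where
  gvar : ℕ → Gate n
  gtop gbot : Gate n
  gand gor : Fin n → Fin n → Gate n
  gbox : Fin n → Gate n

data Gates : ℕ → Set where
  []  : Gates 0
  _▷_ : ∀ {n} → Gates n → Gate n → Gates (suc n)

evalGate : ∀ {n} → Vec Fm n → Gate n → Fm
evalGate v (gvar a) = var a
evalGate v gtop = top
evalGate v gbot = bot
evalGate v (gand i j) = lookup v i ∧ lookup v j
evalGate v (gor i j) = lookup v i ∨ lookup v j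
evalGate v (gbox i) = □ lookup v i

-- formulas computed at each gate, as a vector indexed by gate number
-- (Vec built newest-first, so index 0 is the most recent gate; gates
-- refer to earlier gates through this same vector).
unfoldAll : ∀ {n} → Gates n → Vec Fm n
unfoldAll [] = []v
unfoldAll (gs ▷ g) = evalGate (unfoldAll gs) g ∷v unfoldAll gs

record Circuit : Set where
  constructor circuit
  field
    n     : ℕ
    gates : Gates (suc n)

csize : Circuit → ℕ
csize (circuit n _) = suc n

⟦_⟧ : Circuit → Fm
⟦ circuit n (gs ▷ g) ⟧ = evalGate (unfoldAll gs) g

data Poly2 : Set where
  const : ℕ → Poly2
  X Y   : Poly2
  _⊕_ _⊗_ : Poly2 → Poly2 → Poly2

eval2 : Poly2 → ℕ → ℕ → ℕ
eval2 (const c) x y = c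
eval2 X x y = x
eval2 Y x y = y
eval2 (p ⊕ q) x y = eval2 p x y + eval2 q x y
eval2 (p ⊗ q) x y = eval2 p x y * eval2 q x y

IsMDI : System → Fm → Fm → Fm → Fm → Fm → Set
IsMDI G φ ψ θ I J =
  (∀ a → a ∈ atoms I → a ∈ atoms φ) ×
  (∀ a → a ∈ atoms J → a ∈ atoms φ) ×
  Thm G (φ ⇒ I ∨ J) ×
  Thm G (I ⇒ □ ψ) ×
  Thm G (J ⇒ □ θ)

{-# OPTIONS --safe #-}

-- Idea.  Collect the conclusions □Γ ⇒ □A of the right box inferences of the
-- given proof and read each of them as a Horn clause from Γ to A.  Starting
-- from the boxed subformulas of φ, forward chaining with these clauses
-- computes for every A a monotone formula c A that implies □A; it stabilises
-- after as many rounds as there are clauses, so the c A are computed by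
-- circuits of quadratic size.  Reading □A as c A (for GL) or as c A together
-- with A (for S4) makes every line of the proof true in each propositional
-- valuation.  As φ is monotone it implies its own reading, so the last line
-- shows that φ implies c ψ ∨ c θ.  Propositional completeness of LK turns these
-- truth-value arguments into proofs.
module Submission where

open import Defs
open import Data.Bool using (Bool; true; false; T; not; if_then_else_) renaming (_∧_ to _and_; _∨_ to _or_)
open import Data.Bool.Properties using (T-∧; T-∨; T?)
open import Data.Empty using (⊥-elim)
open import Data.List using (List; []; _∷_; _++_; map; length; concatMap)
open import Data.List.Membership.Propositional using (_∈_; find)
open import Data.List.Membership.Propositional.Properties using (∈-++⁺ˡ; ∈-++⁺ʳ; ∈-++⁻; ∈-∃++)
open import Data.List.Properties using (++-assoc; length-++)
open import Data.List.Relation.Binary.Permutation.Propositional using (_↭_; refl; prep; swap; trans; ↭-sym)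
open import Data.List.Relation.Binary.Permutation.Propositional.Properties using (shift; ++-comm)
open import Data.List.Relation.Binary.Subset.Propositional using (_⊆_)
open import Data.List.Relation.Unary.All as All using (All; []; _∷_)
open import Data.List.Relation.Unary.All.Properties as All using (¬All⇒Any¬)
open import Data.List.Relation.Unary.Any as Any using (Any; here; there)
import Data.List.Relation.Unary.Any.Properties as Any
open import Data.Nat using (ℕ; zero; suc; _+_; _*_; _≤_; _<_; z≤n; s≤s)
open import Data.Nat.Properties
open import Data.Product using (Σ; _×_; _,_; proj₁; proj₂; ∃)
open import Data.Sum as Sum using (_⊎_; inj₁; inj₂; [_,_]′)
open import Data.Unit using (tt)
open import Data.Vec as Vec using (lookup; fromList)
open import Function using (_∘_; id; Equivalence)
open import Relation.Binary using (DecidableEquality)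
open import Relation.Binary.PropositionalEquality using (_≡_; refl; sym; cong; cong₂; subst; subst₂; module ≡-Reasoning)
open import Relation.Nullary using (¬_; Dec; yes; no; does; contradiction)
open import Relation.Nullary.Decidable using (map′; _→-dec_; _×-dec_)

-- Labelled trees; formulas inherit decidable equality from them.
data Tree : Set where
  leaf : Tree
  node : ℕ → Tree → Tree → Tree

_≟ᵗ_ : DecidableEquality Tree
leaf ≟ᵗ leaf = yes refl
leaf ≟ᵗ node _ _ _ = no λ ()
node _ _ _ ≟ᵗ leaf = no λ ()
node m s t ≟ᵗ node n u v =
  map′ (λ { (refl , refl , refl) → refl }) (λ { refl → refl , refl , refl })
       ((m ≟ n) ×-dec (s ≟ᵗ u) ×-dec (t ≟ᵗ v))

encode : Fm → Tree
encode top = node 0 leaf leaf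
encode bot = node 1 leaf leaf
encode (A ∧ B) = node 2 (encode A) (encode B)
encode (A ∨ B) = node 3 (encode A) (encode B)
encode (A ⇒ B) = node 4 (encode A) (encode B)
encode (□ A) = node 5 (encode A) leaf
encode (var a) = node (6 + a) leaf leaf

decode : Tree → Fm
decode leaf = top
decode (node 0 _ _) = top
decode (node 1 _ _) = bot
decode (node 2 s t) = decode s ∧ decode t
decode (node 3 s t) = decode s ∨ decode t
decode (node 4 s t) = decode s ⇒ decode t
decode (node 5 s _) = □ decode s
decode (node (suc (suc (suc (suc (suc (suc a)))))) _ _) = var a

decode-encode : ∀ A → decode (encode A) ≡ A
decode-encode (var a) = refl
decode-encode top = refl
decode-encode bot = refl
decode-encode (A ∧ B) = cong₂ _∧_ (decode-encode A) (decode-encode B)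
decode-encode (A ∨ B) = cong₂ _∨_ (decode-encode A) (decode-encode B)
decode-encode (A ⇒ B) = cong₂ _⇒_ (decode-encode A) (decode-encode B)
decode-encode (□ A) = cong □_ (decode-encode A)

encode-injective : ∀ {A B} → encode A ≡ encode B → A ≡ B
encode-injective {A} {B} eq = begin
  A                 ≡⟨ decode-encode A ⟨
  decode (encode A) ≡⟨ cong decode eq ⟩
  decode (encode B) ≡⟨ decode-encode B ⟩
  B                 ∎
  where open ≡-Reasoning

-- Abstract, so that case distinctions on A ≟ᶠ B also reduce does (A ≟ᶠ B).
abstract
  _≟ᶠ_ : DecidableEquality Fm
  A ≟ᶠ B = map′ encode-injective (cong encode) (encode A ≟ᵗ encode B)

open import Data.List.Membership.DecPropositional _≟ᶠ_ using (_∈?_)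

-- Tree derivations and admissible structural rules.

data Der (G : System) : Sequent → Set where
  by : ∀ {ps s} → Rule G ps s → All (Der G) ps → Der G s

derivations : ∀ {G ss} → Lines G ss → All (Der G) ss
derivations [] = []
derivations (step s ps r premises l) = by r (All.map (All.lookup (derivations l)) premises) ∷ derivations l

-- Lines already present are kept, so premises placed earlier can still be cited when the conclusion
-- is appended. Sizes are not tracked: the theorem bounds the circuits, while for the three
-- implications it asks only for provability.
linearise : ∀ {G s ss} → Lines G ss → Der G s →
            ∃ λ ss′ → Lines G (s ∷ ss′) × ss ⊆ ss′
linearise* : ∀ {G ps ss} → Lines G ss → All (Der G) ps →
             ∃ λ ss′ → Lines G ss′ × ss ⊆ ss′ × All (_∈ ss′) ps
linearise l (by r ds) with linearise* l ds
... | ss′ , l′ , sub , mem = ss′ , step _ _ r mem l′ , sub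
linearise* l [] = _ , l , id , []
linearise* l (d ∷ ds) with linearise* l ds
... | ss₁ , l₁ , sub₁ , mem with linearise l₁ d
...   | ss₂ , l₂ , sub₂ = _ , l₂ , there ∘ sub₂ ∘ sub₁ , here refl ∷ All.map (there ∘ sub₂) mem

theorem : ∀ {G A} → Der G ([] ⊢ A ∷ []) → Thm G A
theorem d with linearise [] d
... | ss , l , _ = proof ss l

module _ {G : System} where

  rule₀ : ∀ {s} → LKRule [] s → Der G s
  rule₀ r = by (lk r) []

  rule₁ : ∀ {p s} → LKRule (p ∷ []) s → Der G p → Der G s
  rule₁ r d = by (lk r) (d ∷ [])

  rule₂ : ∀ {p q s} → LKRule (p ∷ q ∷ []) s → Der G p → Der G q → Der G s
  rule₂ r d e = by (lk r) (d ∷ e ∷ [])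

  -- The prefix `Γ₁` makes the induction go through: `prep` moves the common head into it, and `exL`
  -- permits exchange behind any prefix.
  exchangeˡ : ∀ {Γ Γ′ Δ} Γ₁ → Γ ↭ Γ′ → Der G (Γ₁ ++ Γ ⊢ Δ) → Der G (Γ₁ ++ Γ′ ⊢ Δ)
  exchangeˡ Γ₁ refl d = d
  exchangeˡ {Δ = Δ} Γ₁ (prep {Γ} {Γ′} A p) d =
    subst (λ Θ → Der G (Θ ⊢ Δ)) (++-assoc Γ₁ (A ∷ []) Γ′)
      (exchangeˡ (Γ₁ ++ A ∷ []) p (subst (λ Θ → Der G (Θ ⊢ Δ)) (sym (++-assoc Γ₁ (A ∷ []) Γ)) d))
  exchangeˡ {Δ = Δ} Γ₁ (swap {Γ} {Γ′} A B p) d =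
    subst (λ Θ → Der G (Θ ⊢ Δ)) (++-assoc Γ₁ (B ∷ A ∷ []) Γ′)
      (exchangeˡ (Γ₁ ++ B ∷ A ∷ []) p
        (subst (λ Θ → Der G (Θ ⊢ Δ)) (sym (++-assoc Γ₁ (B ∷ A ∷ []) Γ)) (rule₁ (exL Γ₁ A B) d)))
  exchangeˡ Γ₁ (trans p q) d = exchangeˡ Γ₁ q (exchangeˡ Γ₁ p d)

  exchangeʳ : ∀ {Γ Δ Δ′} Δ₁ → Δ ↭ Δ′ → Der G (Γ ⊢ Δ₁ ++ Δ) → Der G (Γ ⊢ Δ₁ ++ Δ′)
  exchangeʳ Δ₁ refl d = d
  exchangeʳ {Γ} Δ₁ (prep {Δ} {Δ′} A p) d =
    subst (λ Θ → Der G (Γ ⊢ Θ)) (++-assoc Δ₁ (A ∷ []) Δ′)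
      (exchangeʳ (Δ₁ ++ A ∷ []) p (subst (λ Θ → Der G (Γ ⊢ Θ)) (sym (++-assoc Δ₁ (A ∷ []) Δ)) d))
  exchangeʳ {Γ} Δ₁ (swap {Δ} {Δ′} A B p) d =
    subst (λ Θ → Der G (Γ ⊢ Θ)) (++-assoc Δ₁ (B ∷ A ∷ []) Δ′)
      (exchangeʳ (Δ₁ ++ B ∷ A ∷ []) p
        (subst (λ Θ → Der G (Γ ⊢ Θ)) (sym (++-assoc Δ₁ (B ∷ A ∷ []) Δ)) (rule₁ (exR Δ₁ A B) d)))
  exchangeʳ Δ₁ (trans p q) d = exchangeʳ Δ₁ q (exchangeʳ Δ₁ p d)

  contractˡ : ∀ {A Γ Δ} → A ∈ Γ → Der G (A ∷ Γ ⊢ Δ) → Der G (Γ ⊢ Δ)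
  contractˡ {A} A∈Γ d with ∈-∃++ A∈Γ
  ... | Γ₁ , Γ₂ , refl =
    exchangeˡ [] (↭-sym (shift A Γ₁ Γ₂)) (rule₁ (cL A) (exchangeˡ (A ∷ []) (shift A Γ₁ Γ₂) d))

  contractʳ : ∀ {A Γ Δ} → A ∈ Δ → Der G (Γ ⊢ A ∷ Δ) → Der G (Γ ⊢ Δ)
  contractʳ {A} A∈Δ d with ∈-∃++ A∈Δ
  ... | Δ₁ , Δ₂ , refl =
    exchangeʳ [] (↭-sym (shift A Δ₁ Δ₂)) (rule₁ (cR A) (exchangeʳ (A ∷ []) (shift A Δ₁ Δ₂) d))

  -- All of `Γ′` is added by weakening; then each formula of `Γ` is contracted into its occurrence
  -- in `Γ′`. Inclusion as sets thus covers exchange and contraction too.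
  weakenˡ : ∀ {Γ Γ′ Δ} → Γ ⊆ Γ′ → Der G (Γ ⊢ Δ) → Der G (Γ′ ⊢ Δ)
  weakenˡ {Γ} {Γ′} {Δ} sub d = absorb Γ sub (exchangeˡ [] (++-comm Γ′ Γ) (append Γ′))
    where
    append : ∀ Θ → Der G (Θ ++ Γ ⊢ Δ)
    append [] = d
    append (A ∷ Θ) = rule₁ (wL A) (append Θ)
    absorb : ∀ Θ → Θ ⊆ Γ′ → Der G (Θ ++ Γ′ ⊢ Δ) → Der G (Γ′ ⊢ Δ)
    absorb [] _ e = e
    absorb (A ∷ Θ) s e = absorb Θ (s ∘ there) (contractˡ (∈-++⁺ʳ Θ (s (here refl))) e)

  weakenʳ : ∀ {Γ Δ Δ′} → Δ ⊆ Δ′ → Der G (Γ ⊢ Δ) → Der G (Γ ⊢ Δ′)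
  weakenʳ {Γ} {Δ} {Δ′} sub d = absorb Δ sub (exchangeʳ [] (++-comm Δ′ Δ) (append Δ′))
    where
    append : ∀ Θ → Der G (Γ ⊢ Θ ++ Δ)
    append [] = d
    append (A ∷ Θ) = rule₁ (wR A) (append Θ)
    absorb : ∀ Θ → Θ ⊆ Δ′ → Der G (Γ ⊢ Θ ++ Δ′) → Der G (Γ ⊢ Δ′)
    absorb [] _ e = e
    absorb (A ∷ Θ) s e = absorb Θ (s ∘ there) (contractʳ (∈-++⁺ʳ Θ (s (here refl))) e)

  weaken : ∀ {Γ Γ′ Δ Δ′} → Γ ⊆ Γ′ → Δ ⊆ Δ′ → Der G (Γ ⊢ Δ) → Der G (Γ′ ⊢ Δ′)
  weaken s t d = weakenˡ s (weakenʳ t d)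

  axiom : ∀ {A Γ Δ} → A ∈ Γ → A ∈ Δ → Der G (Γ ⊢ Δ)
  axiom p q = weaken (λ { (here refl) → p }) (λ { (here refl) → q }) (rule₀ (ax _))

  additiveCut : ∀ {Γ Δ} A → Der G (Γ ⊢ A ∷ Δ) → Der G (A ∷ Γ ⊢ Δ) → Der G (Γ ⊢ Δ)
  additiveCut {Γ} {Δ} A d e =
    weaken ([ id , id ]′ ∘ ∈-++⁻ Γ) ([ id , id ]′ ∘ ∈-++⁻ Δ) (rule₂ (cut A) d e)

-- Truth-value semantics

sem : (ℕ → Bool) → (Fm → Bool → Bool) → Fm → Bool
sem α β (var a) = α a
sem α β top = true
sem α β bot = false
sem α β (A ∧ B) = sem α β A and sem α β B
sem α β (A ∨ B) = sem α β A or sem α β B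
sem α β (A ⇒ B) = not (sem α β A) or sem α β B
sem α β (□ A) = β A (sem α β A)

-- Only the values of w at variables and boxed formulas matter.
eval : (Fm → Bool) → Fm → Bool
eval w = sem (λ a → w (var a)) (λ A _ → w (□ A))

primes : Fm → List Fm
primes (var a) = var a ∷ []
primes top = []
primes bot = []
primes (A ∧ B) = primes A ++ primes B
primes (A ∨ B) = primes A ++ primes B
primes (A ⇒ B) = primes A ++ primes B
primes (□ A) = □ A ∷ []

_[_≔_] : (Fm → Bool) → Fm → Bool → Fm → Bool
(w [ A ≔ b ]) B = if does (B ≟ᶠ A) then b else w B

record Decides (w : Fm → Bool) (as Γ Δ : List Fm) : Set where
  field
    left  : ∀ {A} → A ∈ as → w A ≡ true → A ∈ Γ
    right : ∀ {A} → A ∈ as → w A ≡ false → A ∈ Δ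
open Decides

restrict : ∀ {w as bs Γ Δ} → as ⊆ bs → Decides w bs Γ Δ → Decides w as Γ Δ
restrict s D .left = left D ∘ s
restrict s D .right = right D ∘ s

-- The update overrides any earlier value of `A`, even if `A` already occurs in `as`. A copy of `A`
-- left on the other side does no harm, since `Decides` demands only memberships.
decide-true : ∀ {w as Γ Δ} A → Decides w as Γ Δ → Decides (w [ A ≔ true ]) (A ∷ as) (A ∷ Γ) Δ
decide-true {w} A D .left {B} m eq with B ≟ᶠ A | m
... | yes refl | _ = here refl
... | no B≢A | here refl = contradiction refl B≢A
... | no B≢A | there m′ = there (left D m′ eq)
decide-true {w} A D .right {B} m eq with B ≟ᶠ A | m | eq
... | yes refl | _ | ()
... | no B≢A | here refl | _ = contradiction refl B≢A
... | no B≢A | there m′ | eq′ = right D m′ eq′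

decide-false : ∀ {w as Γ Δ} A → Decides w as Γ Δ → Decides (w [ A ≔ false ]) (A ∷ as) Γ (A ∷ Δ)
decide-false {w} A D .right {B} m eq with B ≟ᶠ A | m
... | yes refl | _ = here refl
... | no B≢A | here refl = contradiction refl B≢A
... | no B≢A | there m′ = there (right D m′ eq)
decide-false {w} A D .left {B} m eq with B ≟ᶠ A | m | eq
... | yes refl | _ | ()
... | no B≢A | here refl | _ = contradiction refl B≢A
... | no B≢A | there m′ | eq′ = left D m′ eq′

-- Propositional completeness relative to theorems of the calculus.

module _ {G : System} where

  -- A cut on every formula of `as` splits the goal into one sequent per valuation of `as`.
  decided-cases : ∀ as {Γ Δ} →
    (∀ {w Γ′ Δ′} → Γ ⊆ Γ′ → Δ ⊆ Δ′ → Decides w as Γ′ Δ′ → Der G (Γ′ ⊢ Δ′)) → Der G (Γ ⊢ Δ)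
  -- The starting valuation is arbitrary: nothing has been decided yet.
  decided-cases [] k = k {w = λ _ → true} id id (record { left = λ () ; right = λ () })
  decided-cases (A ∷ as) k = decided-cases as λ s t D →
    additiveCut A (k s (there ∘ t) (decide-false A D)) (k (there ∘ s) t (decide-true A D))

  -- Kalmár's lemma, with boxed formulas treated as atoms.
  kalmar : ∀ {w Γ Δ} F → Decides w (primes F) Γ Δ →
    (eval w F ≡ true → Der G (Γ ⊢ F ∷ Δ)) × (eval w F ≡ false → Der G (F ∷ Γ ⊢ Δ))
  kalmar (var a) D =
    (λ eq → axiom (left D (here refl) eq) (here refl)) , (λ eq → axiom (here refl) (right D (here refl) eq))
  kalmar top D = (λ _ → weaken (λ ()) (λ { (here refl) → here refl }) (rule₀ topR)) , λ ()
  kalmar bot D = (λ ()) , λ _ → weaken (λ { (here refl) → here refl }) (λ ()) (rule₀ botL)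
  kalmar {w} (A ∧ B) D
    with eval w A | eval w B | kalmar A (restrict ∈-++⁺ˡ D) | kalmar B (restrict (∈-++⁺ʳ (primes A)) D)
  ... | true  | true  | a , _ | b , _ = (λ _ → rule₂ (andR A B) (a refl) (b refl)) , λ ()
  ... | true  | false | _ | _ , b = (λ ()) , λ _ → rule₁ (andL₂ A B) (b refl)
  ... | false | _     | _ , a | _ = (λ ()) , λ _ → rule₁ (andL₁ A B) (a refl)
  kalmar {w} (A ∨ B) D
    with eval w A | eval w B | kalmar A (restrict ∈-++⁺ˡ D) | kalmar B (restrict (∈-++⁺ʳ (primes A)) D)
  ... | true  | _     | a , _ | _ = (λ _ → rule₁ (orR₁ A B) (a refl)) , λ ()
  ... | false | true  | _ | b , _ = (λ _ → rule₁ (orR₂ A B) (b refl)) , λ ()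
  ... | false | false | _ , a | _ , b = (λ ()) , λ _ → rule₂ (orL A B) (a refl) (b refl)
  kalmar {w} (A ⇒ B) D
    with eval w A | eval w B | kalmar A (restrict ∈-++⁺ˡ D) | kalmar B (restrict (∈-++⁺ʳ (primes A)) D)
  ... | true  | true  | _ | b , _ = (λ _ → rule₁ (impR A B) (rule₁ (wL A) (b refl))) , λ ()
  ... | true  | false | a , _ | _ , b = (λ ()) , λ _ → rule₂ (impL A B) (a refl) (b refl)
  ... | false | _     | _ , a | _ = (λ _ → rule₁ (impR A B) (rule₁ (wR B) (a refl))) , λ ()
  kalmar (□ A) D =
    (λ eq → axiom (left D (here refl) eq) (here refl)) , (λ eq → axiom (here refl) (right D (here refl) eq))

  -- For each valuation of the prime formulas there are two cases. If all of `Hs` are true, then so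
  -- is `F`, and `kalmar` derives it. Otherwise `kalmar` refutes some false `H`, which is cut
  -- against its given derivation.
  completeness : ∀ {Hs F} → All (λ H → Der G ([] ⊢ H ∷ [])) Hs →
    (∀ w → All (T ∘ eval w) Hs → T (eval w F)) → Der G ([] ⊢ F ∷ [])
  completeness {Hs} {F} thms valid = decided-cases (primes F ++ concatMap primes Hs) go
    where
    go : ∀ {w Γ Δ} → [] ⊆ Γ → F ∷ [] ⊆ Δ → Decides w (primes F ++ concatMap primes Hs) Γ Δ → Der G (Γ ⊢ Δ)
    go {w} {Γ} {Δ} _ F∈Δ D with All.all? (T? ∘ eval w) Hs
    ... | yes hs = contractʳ (F∈Δ (here refl)) (proj₁ (kalmar F (restrict ∈-++⁺ˡ D)) (T⇒≡ (valid w hs)))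
      where
      T⇒≡ : ∀ {b} → T b → b ≡ true
      T⇒≡ {true} _ = refl
    ... | no ¬hs with find (¬All⇒Any¬ (T? ∘ eval w) Hs ¬hs)
    ...   | H , H∈Hs , ¬H =
      additiveCut H
        (weaken (λ ()) (λ { (here refl) → here refl }) (All.lookup thms H∈Hs))
        (proj₂ (kalmar H (restrict (∈-++⁺ʳ (primes F) ∘ Any.concat⁺ ∘ Any.map⁺ ∘ pick H∈Hs) D)) (¬T⇒≡ ¬H))
      where
      pick : ∀ {H B Hs} → H ∈ Hs → B ∈ primes H → Any (λ H → B ∈ primes H) Hs
      pick (here refl) m = here m
      pick (there p) m = there (pick p m)
      ¬T⇒≡ : ∀ {b} → ¬ T b → b ≡ false
      ¬T⇒≡ {false} _ = refl
      ¬T⇒≡ {true} ¬t = contradiction tt ¬t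

-- Circuits as straight-line lists of formulas

data Gated (L : List Fm) : Fm → Set where
  gvar : ∀ a → Gated L (var a)
  gtop : Gated L top
  gbot : Gated L bot
  gand : ∀ {A B} → A ∈ L → B ∈ L → Gated L (A ∧ B)
  gor  : ∀ {A B} → A ∈ L → B ∈ L → Gated L (A ∨ B)
  gbox : ∀ {A} → A ∈ L → Gated L (□ A)

data Straight : List Fm → Set where
  []  : Straight []
  _∷_ : ∀ {A L} → Gated L A → Straight L → Straight (A ∷ L)

gated-mono : ∀ {L L′ A} → L ⊆ L′ → Gated L A → Gated L′ A
gated-mono s (gvar a) = gvar a
gated-mono s gtop = gtop
gated-mono s gbot = gbot
gated-mono s (gand p q) = gand (s p) (s q)
gated-mono s (gor p q) = gor (s p) (s q)
gated-mono s (gbox p) = gbox (s p)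

straight-++ : ∀ {L L′} → Straight L → Straight L′ → Straight (L ++ L′)
straight-++ [] t = t
straight-++ (g ∷ s) t = gated-mono ∈-++⁺ˡ g ∷ straight-++ s t

toGate : ∀ {L A} → Gated L A → Gate (length L)
toGate (gvar a) = gvar a
toGate gtop = gtop
toGate gbot = gbot
toGate (gand p q) = gand (Any.index p) (Any.index q)
toGate (gor p q) = gor (Any.index p) (Any.index q)
toGate (gbox p) = gbox (Any.index p)

lookup-index : ∀ {L : List Fm} {A} (p : A ∈ L) → lookup (fromList L) (Any.index p) ≡ A
lookup-index (here refl) = refl
lookup-index (there p) = lookup-index p

evalGate-toGate : ∀ {L A} (g : Gated L A) → evalGate (fromList L) (toGate g) ≡ A
evalGate-toGate (gvar a) = refl
evalGate-toGate gtop = refl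
evalGate-toGate gbot = refl
evalGate-toGate (gand p q) = cong₂ _∧_ (lookup-index p) (lookup-index q)
evalGate-toGate (gor p q) = cong₂ _∨_ (lookup-index p) (lookup-index q)
evalGate-toGate (gbox p) = cong □_ (lookup-index p)

toGates : ∀ {L} → Straight L → Gates (length L)
toGates [] = []
toGates (g ∷ s) = toGates s ▷ toGate g

unfoldAll-toGates : ∀ {L} (s : Straight L) → unfoldAll (toGates s) ≡ fromList L
unfoldAll-toGates [] = refl
unfoldAll-toGates (g ∷ s) rewrite unfoldAll-toGates s = cong (Vec._∷ _) (evalGate-toGate g)

-- The output of a circuit is its newest gate, so the entries added after `A` are dropped.
circuitFor : ∀ {L A} → Straight L → A ∈ L → Σ Circuit λ C → ⟦ C ⟧ ≡ A × csize C ≤ length L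
circuitFor (g ∷ s) (here refl) = circuit _ (toGates (g ∷ s)) , value , ≤-refl
  where
  value : evalGate (unfoldAll (toGates s)) (toGate g) ≡ _
  value rewrite unfoldAll-toGates s = evalGate-toGate g
circuitFor (g ∷ s) (there p) with circuitFor s p
... | C , eq , le = C , eq , m≤n⇒m≤1+n le

subformulas : Fm → List Fm
subformulas (var a) = var a ∷ []
subformulas top = top ∷ []
subformulas bot = bot ∷ []
subformulas (A ∧ B) = A ∧ B ∷ subformulas A ++ subformulas B
subformulas (A ∨ B) = A ∨ B ∷ subformulas A ++ subformulas B
subformulas (A ⇒ B) = A ⇒ B ∷ subformulas A ++ subformulas B
subformulas (□ A) = □ A ∷ subformulas A

self∈subformulas : ∀ A → A ∈ subformulas A
self∈subformulas (var a) = here refl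
self∈subformulas top = here refl
self∈subformulas bot = here refl
self∈subformulas (A ∧ B) = here refl
self∈subformulas (A ∨ B) = here refl
self∈subformulas (A ⇒ B) = here refl
self∈subformulas (□ A) = here refl

length-subformulas : ∀ A → length (subformulas A) ≡ fsize A
length-subformulas₂ : ∀ A B → length (subformulas A ++ subformulas B) ≡ fsize A + fsize B
length-subformulas (var a) = refl
length-subformulas top = refl
length-subformulas bot = refl
length-subformulas (A ∧ B) = cong suc (length-subformulas₂ A B)
length-subformulas (A ∨ B) = cong suc (length-subformulas₂ A B)
length-subformulas (A ⇒ B) = cong suc (length-subformulas₂ A B)
length-subformulas (□ A) = cong suc (length-subformulas A)
length-subformulas₂ A B rewrite length-++ (subformulas A) {subformulas B} =
  cong₂ _+_ (length-subformulas A) (length-subformulas B)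

straight-subformulas : ∀ {A} → Monotone A → Straight (subformulas A)
straight-subformulas (mvar a) = gvar a ∷ []
straight-subformulas mtop = gtop ∷ []
straight-subformulas mbot = gbot ∷ []
straight-subformulas (mand {A} {B} m n) =
  gand (∈-++⁺ˡ (self∈subformulas A)) (∈-++⁺ʳ (subformulas A) (self∈subformulas B))
    ∷ straight-++ (straight-subformulas m) (straight-subformulas n)
straight-subformulas (mor {A} {B} m n) =
  gor (∈-++⁺ˡ (self∈subformulas A)) (∈-++⁺ʳ (subformulas A) (self∈subformulas B))
    ∷ straight-++ (straight-subformulas m) (straight-subformulas n)
straight-subformulas (mbox {A} m) = gbox (self∈subformulas A) ∷ straight-subformulas m

atoms-subformula : ∀ {A} B → A ∈ subformulas B → atoms A ⊆ atoms B
atoms-subformula₂ : ∀ {A} B C → A ∈ subformulas B ++ subformulas C → atoms A ⊆ atoms B ++ atoms C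
atoms-subformula (var a) (here refl) = id
atoms-subformula top (here refl) = id
atoms-subformula bot (here refl) = id
atoms-subformula (B ∧ C) (here refl) = id
atoms-subformula (B ∧ C) (there p) = atoms-subformula₂ B C p
atoms-subformula (B ∨ C) (here refl) = id
atoms-subformula (B ∨ C) (there p) = atoms-subformula₂ B C p
atoms-subformula (B ⇒ C) (here refl) = id
atoms-subformula (B ⇒ C) (there p) = atoms-subformula₂ B C p
atoms-subformula (□ B) (here refl) = id
atoms-subformula (□ B) (there p) = atoms-subformula B p
atoms-subformula₂ B C p with ∈-++⁻ (subformulas B) p
... | inj₁ q = ∈-++⁺ˡ ∘ atoms-subformula B q
... | inj₂ q = ∈-++⁺ʳ (atoms B) ∘ atoms-subformula C q

-- Forward chaining

Clause : Set
Clause = List Fm × Fm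

Satisfies : (Fm → Bool) → Clause → Set
Satisfies g (Γ , B) = All (T ∘ g) Γ → T (g B)

satisfies? : ∀ g c → Dec (Satisfies g c)
satisfies? g (Γ , B) = All.all? (T? ∘ g) Γ →-dec T? (g B)

conj : (Fm → Fm) → List Fm → Fm
conj f [] = top
conj f (A ∷ Γ) = f A ∧ conj f Γ

-- One simultaneous round: all bodies use the values `f` of the previous round. The innermost
-- disjunct `f A` makes successive rounds increasing.
fire : (Fm → Fm) → List Clause → Fm → Fm
fire f [] A = f A
fire f ((Γ , B) ∷ cs) A = if does (A ≟ᶠ B) then conj f Γ ∨ fire f cs A else fire f cs A

-- The gates added by a round: per clause one disjunction, `length Γ` conjunctions and one `top`.
cost : List Clause → ℕ
cost [] = 0
cost ((Γ , _) ∷ cs) = 2 + length Γ + cost cs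

length≤cost : ∀ cs → length cs ≤ cost cs
length≤cost [] = z≤n
length≤cost ((Γ , _) ∷ cs) = s≤s (≤-trans (length≤cost cs) (m≤n+m (cost cs) (suc (length Γ))))

record Extension (L : List Fm) (k : ℕ) : Set where
  constructor extension
  field
    {list}   : List Fm
    straight : Straight list
    extends  : L ⊆ list
    size     : length list ≡ k + length L
open Extension

_∷ᵉ_ : ∀ {L k A} (E : Extension L k) → Gated (list E) A → Extension L (suc k)
E ∷ᵉ g = extension (g ∷ straight E) (there ∘ extends E) (cong suc (size E))

straight-conj : ∀ {f L} → Straight L → (∀ A → f A ∈ L) → ∀ Γ →
  Σ (Extension L (suc (length Γ))) λ E → conj f Γ ∈ list E
straight-conj s cov [] = extension s id refl ∷ᵉ gtop , here refl
straight-conj s cov (A ∷ Γ) with straight-conj s cov Γ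
... | E , p = E ∷ᵉ gand (extends E (cov A)) p , here refl

-- One finite list serves all the infinitely many `A`: a clause alters the value at its head only,
-- so one new disjunction is added and every other formula keeps its entry.
straight-fire : ∀ {f L} → Straight L → (∀ A → f A ∈ L) → ∀ cs →
  Σ (Extension L (cost cs)) λ E → ∀ A → fire f cs A ∈ list E
straight-fire s cov [] = extension s id refl , cov
straight-fire {f} {L} s cov ((Γ , B) ∷ cs) with straight-fire s cov cs
... | E , covE with straight-conj (straight E) (extends E ∘ cov) Γ
...   | F , p = extension (gor p (extends F (covE B)) ∷ straight F) (there ∘ extends F ∘ extends E) sz , covF
  where
  open ≡-Reasoning
  sz : suc (length (list F)) ≡ 2 + length Γ + cost cs + length L
  sz = begin
    suc (length (list F))                 ≡⟨ cong suc (size F) ⟩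
    2 + length Γ + length (list E)        ≡⟨ cong (2 + length Γ +_) (size E) ⟩
    2 + length Γ + (cost cs + length L)   ≡⟨ +-assoc (2 + length Γ) (cost cs) (length L) ⟨
    2 + length Γ + cost cs + length L     ∎
  covF : ∀ A → fire f ((Γ , B) ∷ cs) A ∈ conj f Γ ∨ fire f cs B ∷ list F
  covF A with A ≟ᶠ B
  ... | yes refl = here refl
  ... | no _ = there (extends F (covE A))

atoms-conj : ∀ {f as} → (∀ A → atoms (f A) ⊆ as) → ∀ Γ → atoms (conj f Γ) ⊆ as
atoms-conj sub [] ()
atoms-conj {f} sub (A ∷ Γ) = [ sub A , atoms-conj sub Γ ]′ ∘ ∈-++⁻ (atoms (f A))

atoms-fire : ∀ {f as} → (∀ A → atoms (f A) ⊆ as) → ∀ cs A → atoms (fire f cs A) ⊆ as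
atoms-fire sub [] A = sub A
atoms-fire {f} sub ((Γ , B) ∷ cs) A with A ≟ᶠ B
... | yes _ = [ atoms-conj sub Γ , atoms-fire sub cs A ]′ ∘ ∈-++⁻ (atoms (conj f Γ))
... | no _ = atoms-fire sub cs A

T-∧⁻ : ∀ {x y} → T (x and y) → T x × T y
T-∧⁻ = Equivalence.to T-∧

T-∧⁺ : ∀ {x y} → T x → T y → T (x and y)
T-∧⁺ p q = Equivalence.from T-∧ (p , q)

T-∨⁻ : ∀ {x y} → T (x or y) → T x ⊎ T y
T-∨⁻ = Equivalence.to T-∨

T-∨⁺ : ∀ {x y} → T x ⊎ T y → T (x or y)
T-∨⁺ = Equivalence.from T-∨

T-⇒⁻ : ∀ {x y} → T (not x or y) → T x → T y
T-⇒⁻ {true} t _ = t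

T-⇒⁺ : ∀ {x y} → (T x → T y) → T (not x or y)
T-⇒⁺ {true} f = f tt
T-⇒⁺ {false} f = tt

module _ (w : Fm → Bool) (f : Fm → Fm) where

  private
    holds : (Fm → Fm) → Fm → Bool
    holds h A = eval w (h A)

  eval-conj⁻ : ∀ Γ → T (eval w (conj f Γ)) → All (T ∘ holds f) Γ
  eval-conj⁻ [] _ = []
  eval-conj⁻ (A ∷ Γ) t with T-∧⁻ t
  ... | p , q = p ∷ eval-conj⁻ Γ q

  eval-conj⁺ : ∀ {Γ} → All (T ∘ holds f) Γ → T (eval w (conj f Γ))
  eval-conj⁺ [] = tt
  eval-conj⁺ (p ∷ ps) = T-∧⁺ p (eval-conj⁺ ps)

  eval-fire⁻ : ∀ cs {A} → T (eval w (fire f cs A)) →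
    T (eval w (f A)) ⊎ (∃ λ Γ → (Γ , A) ∈ cs × All (T ∘ holds f) Γ)
  eval-fire⁻ [] t = inj₁ t
  eval-fire⁻ ((Γ , B) ∷ cs) {A} t with A ≟ᶠ B
  ... | no _ = Sum.map₂ (λ { (Θ , m , h) → Θ , there m , h }) (eval-fire⁻ cs t)
  ... | yes refl with T-∨⁻ t
  ...   | inj₁ c = inj₂ (Γ , here refl , eval-conj⁻ Γ c)
  ...   | inj₂ t′ = Sum.map₂ (λ { (Θ , m , h) → Θ , there m , h }) (eval-fire⁻ cs t′)

  fire-extensive : ∀ cs {A} → T (eval w (f A)) → T (eval w (fire f cs A))
  fire-extensive [] t = t
  fire-extensive ((Γ , B) ∷ cs) {A} t with A ≟ᶠ B
  ... | yes _ = T-∨⁺ (inj₂ (fire-extensive cs t))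
  ... | no _ = fire-extensive cs t

  fire-clause : ∀ cs {Γ A} → (Γ , A) ∈ cs → All (T ∘ holds f) Γ → T (eval w (fire f cs A))
  fire-clause ((Γ , B) ∷ cs) {A = A} m h with A ≟ᶠ B | m
  ... | yes _  | here refl = T-∨⁺ (inj₁ (eval-conj⁺ h))
  ... | yes _  | there m′ = T-∨⁺ {eval w (conj f Γ)} (inj₂ (fire-clause cs m′ h))
  ... | no A≢B | here refl = contradiction refl A≢B
  ... | no _   | there m′ = fire-clause cs m′ h

-- The progress measure for chaining. Clauses are counted, not distinct heads, which bounds it by
-- `length cs`.
falseHeads : (Fm → Bool) → List Clause → ℕ
falseHeads g [] = 0
falseHeads g ((_ , B) ∷ cs) = (if g B then 0 else 1) + falseHeads g cs

falseHeads≤length : ∀ g cs → falseHeads g cs ≤ length cs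
falseHeads≤length g [] = z≤n
falseHeads≤length g ((_ , B) ∷ cs) with g B
... | true = m≤n⇒m≤1+n (falseHeads≤length g cs)
... | false = s≤s (falseHeads≤length g cs)

module _ {g h : Fm → Bool} (g≤h : ∀ {A} → T (g A) → T (h A)) where

  falseHeads-head : ∀ B → (if h B then 0 else 1) ≤ (if g B then 0 else 1)
  falseHeads-head B with g B | h B | g≤h {B}
  ... | true  | true  | _ = z≤n
  ... | true  | false | k = ⊥-elim (k tt)
  ... | false | true  | _ = z≤n
  ... | false | false | _ = ≤-refl

  falseHeads-anti : ∀ cs → falseHeads h cs ≤ falseHeads g cs
  falseHeads-anti [] = z≤n
  falseHeads-anti ((_ , B) ∷ cs) = +-mono-≤ (falseHeads-head B) (falseHeads-anti cs)

  falseHeads-strict : ∀ {Γ B cs} → (Γ , B) ∈ cs → ¬ T (g B) → T (h B) → falseHeads h cs < falseHeads g cs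
  falseHeads-strict {B = B} {c ∷ cs} (here refl) ¬t t with g B | h B
  ... | true  | _ = contradiction tt ¬t
  ... | false | true = s≤s (falseHeads-anti cs)
  falseHeads-strict {cs = (_ , B) ∷ cs} (there m) ¬t t =
    +-mono-≤-< (falseHeads-head B) (falseHeads-strict m ¬t t)

unsatisfied-head : ∀ {g c} → ¬ Satisfies g c → All (T ∘ g) (proj₁ c) × ¬ T (g (proj₂ c))
unsatisfied-head {g} {Γ , B} ¬s with All.all? (T? ∘ g) Γ
... | yes hs = hs , λ t → ¬s (λ _ → t)
... | no ¬hs = contradiction (λ hs → contradiction hs ¬hs) ¬s

-- Stages of forward chaining and their stabilisation.

module Chaining (φ : Fm) (cs : List Clause) where

  -- The facts are the boxed subformulas of `φ`, so every stage uses only atoms of `φ` and, for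
  -- monotone `φ`, only monotone gates. The default `bot` stands for a box not yet derived.
  stage : ℕ → Fm → Fm
  stage zero A = if does (□ A ∈? subformulas φ) then □ A else bot
  stage (suc t) = fire (stage t) cs

  atoms-stage : ∀ t A → atoms (stage t A) ⊆ atoms φ
  atoms-stage zero A with □ A ∈? subformulas φ
  ... | yes m = atoms-subformula φ m
  ... | no _ = λ ()
  atoms-stage (suc t) = atoms-fire (atoms-stage t) cs

  straight-stage : Monotone φ → ∀ t →
    Σ (List Fm) λ L → Straight L × (∀ A → stage t A ∈ L) × length L ≡ t * cost cs + suc (fsize φ)
  -- The extra entry `bot` is shared by all `A` whose box does not occur in `φ`; it accounts for the
  -- `suc` in the length.
  straight-stage m zero = bot ∷ subformulas φ , gbot ∷ straight-subformulas m , cov , cong suc (length-subformulas φ)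
    where
    cov : ∀ A → stage 0 A ∈ bot ∷ subformulas φ
    cov A with □ A ∈? subformulas φ
    ... | yes p = there p
    ... | no _ = here refl
  straight-stage m (suc t) with straight-stage m t
  ... | L , s , cov , len with straight-fire s cov cs
  ...   | E , covE = list E , straight E , covE , (begin
    length (list E)                             ≡⟨ size E ⟩
    cost cs + length L                          ≡⟨ cong (cost cs +_) len ⟩
    cost cs + (t * cost cs + suc (fsize φ))     ≡⟨ +-assoc (cost cs) (t * cost cs) _ ⟨
    suc t * cost cs + suc (fsize φ)             ∎)
    where open ≡-Reasoning

  circuit-stage : Monotone φ → ∀ t A →
    Σ Circuit λ C → ⟦ C ⟧ ≡ stage t A × csize C ≤ t * cost cs + suc (fsize φ)
  circuit-stage m t A with straight-stage m t
  ... | L , s , cov , len with circuitFor s (cov A)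
  ...   | C , eq , le = C , eq , ≤-trans le (≤-reflexive len)

  -- A fact is the box itself, and each firing is justified by its clause, read as an implication
  -- from `□* Γ` to `□ A` that holds in `w`.
  stage-sound : ∀ w → (∀ {Γ A} → (Γ , A) ∈ cs → All (λ B → T (w (□ B))) Γ → T (w (□ A))) →
    ∀ t {A} → T (eval w (stage t A)) → T (w (□ A))
  stage-sound w ok zero {A} h with □ A ∈? subformulas φ
  ... | yes _ = h
  stage-sound w ok (suc t) h with eval-fire⁻ w (stage t) cs h
  ... | inj₁ h′ = stage-sound w ok t h′
  ... | inj₂ (Γ , m , hs) = ok m (All.map (stage-sound w ok t) hs)

  module _ (w : Fm → Bool) where

    value : ℕ → Fm → Bool
    value t A = eval w (stage t A)

    Closed : ℕ → Set
    Closed t = All (Satisfies (value t)) cs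

    value-mono : ∀ t {A} → T (value 0 A) → T (value t A)
    value-mono zero h = h
    value-mono (suc t) h = fire-extensive w (stage t) cs (value-mono t h)

    value-initial : ∀ t {A} → □ A ∈ subformulas φ → T (w (□ A)) → T (value t A)
    value-initial t {A} m h = value-mono t initial
      where
      initial : T (value 0 A)
      initial with □ A ∈? subformulas φ
      ... | yes _ = h
      ... | no ¬m = contradiction m ¬m

    -- Once all clauses are satisfied, a further round makes nothing new true.
    closed-suc : ∀ t → Closed t → Closed (suc t)
    closed-suc t closed = All.map (λ sat hs → fire-extensive w (stage t) cs (sat (All.map stable hs))) closed
      where
      stable : ∀ {A} → T (value (suc t) A) → T (value t A)
      stable h with eval-fire⁻ w (stage t) cs h
      ... | inj₁ h′ = h′
      ... | inj₂ (Γ , m , hs) = All.lookup closed m hs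

    -- An unsatisfied clause has a true body and a false head. The next round makes that head true,
    -- so each round before closure lowers `falseHeads` by at least one.
    closed-or-progress : ∀ t → Closed t ⊎ t + falseHeads (value t) cs ≤ length cs
    closed-or-progress zero = inj₂ (falseHeads≤length (value 0) cs)
    closed-or-progress (suc t) with closed-or-progress t
    ... | inj₁ closed = inj₁ (closed-suc t closed)
    ... | inj₂ le with All.all? (satisfies? (value t)) cs
    ...   | yes closed = inj₁ (closed-suc t closed)
    ...   | no ¬closed with find (¬All⇒Any¬ (satisfies? (value t)) cs ¬closed)
    ...     | (Γ , B) , m , ¬sat with unsatisfied-head ¬sat
    ...       | hs , ¬h = inj₂ (≤-trans (+-monoʳ-< t drop) le)
      where
      drop : falseHeads (value (suc t)) cs < falseHeads (value t) cs
      drop = falseHeads-strict (fire-extensive w (stage t) cs) m ¬h (fire-clause w (stage t) cs m hs)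

    closed-final : Closed (length cs)
    closed-final with closed-or-progress (length cs)
    ... | inj₁ closed = closed
    ... | inj₂ le with All.all? (satisfies? (value (length cs))) cs
    ...   | yes closed = closed
    ...   | no ¬closed with find (¬All⇒Any¬ (satisfies? (value (length cs))) cs ¬closed)
    ...     | (Γ , B) , m , ¬sat =
      contradiction (≤-trans (+-monoʳ-< (length cs) some) le) (≤⇒≯ (m≤m+n (length cs) 0))
      where
      some : 0 < falseHeads (value (length cs)) cs
      -- Comparison with the everywhere true valuation shows that a false head makes the count
      -- positive, whereas after `length cs` rounds of progress it would have to be zero.
      some = ≤-<-trans z≤n (falseHeads-strict {h = λ _ → true} (λ _ → tt) m (proj₂ (unsatisfied-head ¬sat)) tt)

-- Soundness

True : (Fm → Bool) → Sequent → Set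
True v (Γ ⊢ Δ) = All (T ∘ v) Γ → Any (T ∘ v) Δ

module _ (α : ℕ → Bool) (β : Fm → Bool → Bool) where

  private
    v : Fm → Bool
    v = sem α β

  -- No rule of LK looks inside a box, so boxes may be interpreted by any `β`.
  lk-sound : ∀ {ps s} → LKRule ps s → All (True v) ps → True v s
  lk-sound (ax A) [] (h ∷ []) = here h
  lk-sound topR [] [] = here tt
  lk-sound botL [] (() ∷ _)
  lk-sound (wL A) (p ∷ []) (_ ∷ hs) = p hs
  lk-sound (wR A) (p ∷ []) hs = there (p hs)
  lk-sound (cL A) (p ∷ []) (h ∷ hs) = p (h ∷ h ∷ hs)
  lk-sound (cR A) (p ∷ []) hs with p hs
  ... | here t = here t
  ... | there t = t
  lk-sound (exL Γ₁ A B) (p ∷ []) hs with All.++⁻ Γ₁ hs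
  ... | hs₁ , b ∷ a ∷ hs₂ = p (All.++⁺ hs₁ (a ∷ b ∷ hs₂))
  lk-sound (exR Δ₁ A B) (p ∷ []) hs with Any.++⁻ Δ₁ (p hs)
  ... | inj₁ t = Any.++⁺ˡ t
  ... | inj₂ (here a) = Any.++⁺ʳ Δ₁ (there (here a))
  ... | inj₂ (there (here b)) = Any.++⁺ʳ Δ₁ (here b)
  ... | inj₂ (there (there t)) = Any.++⁺ʳ Δ₁ (there (there t))
  lk-sound (cut {Γ} {Δ} A) (p ∷ q ∷ []) hs with All.++⁻ Γ hs
  ... | hs₁ , hs₂ with p hs₁
  ...   | here a = Any.++⁺ʳ Δ (q (a ∷ hs₂))
  ...   | there t = Any.++⁺ˡ t
  lk-sound (andL₁ A B) (p ∷ []) (h ∷ hs) = p (proj₁ (T-∧⁻ h) ∷ hs)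
  lk-sound (andL₂ A B) (p ∷ []) (h ∷ hs) = p (proj₂ (T-∧⁻ {v A} h) ∷ hs)
  lk-sound (andR A B) (p ∷ q ∷ []) hs with p hs | q hs
  ... | here a | here b = here (T-∧⁺ a b)
  ... | there t | _ = there t
  ... | _ | there t = there t
  lk-sound (orL A B) (p ∷ q ∷ []) (h ∷ hs) with T-∨⁻ {v A} h
  ... | inj₁ a = p (a ∷ hs)
  ... | inj₂ b = q (b ∷ hs)
  lk-sound (orR₁ A B) (p ∷ []) hs with p hs
  ... | here a = here (T-∨⁺ (inj₁ a))
  ... | there t = there t
  lk-sound (orR₂ A B) (p ∷ []) hs with p hs
  ... | here b = here (T-∨⁺ {v A} (inj₂ b))
  ... | there t = there t
  lk-sound (impL A B) (p ∷ q ∷ []) (h ∷ hs) with p hs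
  ... | here a = q (T-⇒⁻ h a ∷ hs)
  ... | there t = t
  lk-sound (impR A B) (p ∷ []) hs with T? (v A)
  ... | no ¬a = here (T-⇒⁺ {v A} (λ a → contradiction a ¬a))
  ... | yes a with p (a ∷ hs)
  ...   | here b = here (T-⇒⁺ {v A} (λ _ → b))
  ...   | there t = there t

-- Clauses extracted from a proof, and the reading of its lines.

clauses : ∀ {G ss} → Lines G ss → List Clause
clauses [] = []
clauses (step s ps (lk r) premises l) = clauses l
clauses (step s ps (modal (boxL-S4 A)) premises l) = clauses l
clauses (step s ps (modal (boxR-S4 Γ A)) premises l) = (Γ , A) ∷ clauses l
clauses (step s ps (modal (boxR-GL Γ A)) premises l) = (Γ , A) ∷ clauses l

clause-line : ∀ {G ss} (l : Lines G ss) {Γ A} → (Γ , A) ∈ clauses l → (□* Γ ⊢ □ A ∷ []) ∈ ss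
clause-line (step s ps (lk r) premises l) m = there (clause-line l m)
clause-line (step s ps (modal (boxL-S4 A)) premises l) m = there (clause-line l m)
clause-line (step s ps (modal (boxR-S4 Γ A)) premises l) (here refl) = here refl
clause-line (step s ps (modal (boxR-S4 Γ A)) premises l) (there m) = there (clause-line l m)
clause-line (step s ps (modal (boxR-GL Γ A)) premises l) (here refl) = here refl
clause-line (step s ps (modal (boxR-GL Γ A)) premises l) (there m) = there (clause-line l m)

totalSize : List Sequent → ℕ
totalSize [] = 0
totalSize (s ∷ ss) = ssize s + totalSize ss

length≤lsize-□* : ∀ Γ → length Γ ≤ lsize (□* Γ)
length≤lsize-□* [] = z≤n
length≤lsize-□* (A ∷ Γ) = s≤s (≤-trans (length≤lsize-□* Γ) (m≤n+m _ (fsize A)))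

-- The `2` is paid by the `suc` in `ssize` and by the box of the succedent. Each clause is thereby
-- charged to its own line.
clause-size : ∀ Γ A → 2 + length Γ ≤ ssize (□* Γ ⊢ □ A ∷ [])
clause-size Γ A = s≤s (≤-trans (≤-reflexive (+-comm 1 (length Γ))) (+-mono-≤ (length≤lsize-□* Γ) (s≤s z≤n)))

cost-clauses : ∀ {G ss} (l : Lines G ss) → cost (clauses l) ≤ totalSize ss
cost-clauses [] = z≤n
cost-clauses (step s ps (lk r) premises l) = ≤-trans (cost-clauses l) (m≤n+m _ (ssize s))
cost-clauses (step s ps (modal (boxL-S4 A)) premises l) = ≤-trans (cost-clauses l) (m≤n+m _ (ssize s))
cost-clauses (step s ps (modal (boxR-S4 Γ A)) premises l) = +-mono-≤ (clause-size Γ A) (cost-clauses l)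
cost-clauses (step s ps (modal (boxR-GL Γ A)) premises l) = +-mono-≤ (clause-size Γ A) (cost-clauses l)

-- The recursion inside psize cannot be named outside Defs, but it ignores the
-- proof around it, so it can be reached through proofs of top.
psize-top : ∀ {G ss} (l : Lines G ss) → psize (proof ss (step ([] ⊢ top ∷ []) [] (lk topR) [] l)) ≡ 2 + totalSize ss
psize-top [] = refl
psize-top (step s ps r premises l) =
  cong (λ n → 2 + (ssize s + n)) (suc-injective (suc-injective (psize-top l)))

psize-totalSize : ∀ {G χ} (u : GProof G χ) → psize u ≡ totalSize (([] ⊢ χ ∷ []) ∷ GProof.earlier u)
psize-totalSize {χ = χ} (proof earlier (step s ps r premises l)) =
  cong (ssize ([] ⊢ χ ∷ []) +_) (suc-injective (suc-injective (psize-top l)))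

-- In S4 the conjunct `x`, the reading of `A` itself, validates the left box rule. GL has no such
-- rule, and there `c A` suffices.
boxReading : System → (Fm → Bool) → Fm → Bool → Bool
boxReading S4 c A x = c A and x
boxReading GL c A x = c A

module Reading (G : System) (α : ℕ → Bool) (c : Fm → Bool) where

  reading : Fm → Bool
  reading = sem α (boxReading G c)

  reading-□ : ∀ {A} → T (reading (□ A)) → T (c A)
  reading-□ h = lemma G h
    where
    lemma : ∀ G {A x} → T (boxReading G c A x) → T (c A)
    lemma S4 h = proj₁ (T-∧⁻ h)
    lemma GL h = h

  reading-□* : ∀ {Γ} → All (T ∘ reading) (□* Γ) → All (T ∘ c) Γ
  reading-□* hs = All.map reading-□ (All.map⁻ hs)

-- At a right box inference `c A` is true because `c` satisfies the corresponding clause. In S4 the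
-- second conjunct comes from the premise, whose antecedent is the same `□* Γ`.
lines-true : ∀ {G ss} (l : Lines G ss) α c → All (Satisfies c) (clauses l) → All (True (Reading.reading G α c)) ss
lines-true [] α c sat = []
lines-true {G} (step s ps (lk r) premises l) α c sat with lines-true l α c sat
... | hs = lk-sound α (boxReading G c) r (All.map (All.lookup hs) premises) ∷ hs
lines-true (step s ps (modal (boxL-S4 A)) (p ∷ []) l) α c sat with lines-true l α c sat
... | hs = (λ { (h ∷ hΓ) → All.lookup hs p (proj₂ (T-∧⁻ {c A} h) ∷ hΓ) }) ∷ hs
lines-true (step s ps (modal (boxR-S4 Γ A)) (p ∷ []) l) α c (sat ∷ sats) with lines-true l α c sats
... | hs = line ∷ hs
  where
  open Reading S4 α c
  line : True reading (□* Γ ⊢ □ A ∷ [])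
  line hΓ with All.lookup hs p hΓ
  ... | here a = here (T-∧⁺ (sat (reading-□* hΓ)) a)
lines-true (step s ps (modal (boxR-GL Γ A)) premises l) α c (sat ∷ sats) =
  (λ hΓ → here (sat (Reading.reading-□* GL α c hΓ))) ∷ lines-true l α c sats

-- A propositional valuation may make `□ A` true and `A` false, whereas the S4 reading of `□ A` also
-- demands `A`. These theorems of S4 exclude such valuations for the subformulas of `φ`.
reflection : System → Fm → List Fm
reflection S4 φ = map (λ A → □ A ⇒ A) (subformulas φ)
reflection GL φ = []

derive-reflection : ∀ G φ → All (λ H → Der G ([] ⊢ H ∷ [])) (reflection G φ)
derive-reflection S4 φ = All.map⁺ (All.universal
  (λ A → rule₁ (impR (□ A) A) (by (modal (boxL-S4 A)) (rule₀ (ax A) ∷ []))) (subformulas φ))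
derive-reflection GL φ = []

boxReading-intro : ∀ G {φ w c A x} → All (T ∘ eval w) (reflection G φ) → A ∈ subformulas φ →
  T (w (□ A)) → T (c A) → (T (eval w A) → T x) → T (boxReading G c A x)
boxReading-intro S4 reflects m h cA k = T-∧⁺ cA (k (T-⇒⁻ (All.lookup (All.map⁻ reflects) m) h))
boxReading-intro GL reflects m h cA k = cA

module _ (G : System) (φ : Fm) (w c : Fm → Bool)
         (c-initial : ∀ {A} → □ A ∈ subformulas φ → T (w (□ A)) → T (c A))
         (reflects : All (T ∘ eval w) (reflection G φ)) where

  open Reading G (λ a → w (var a)) c

  -- Truth passes from `w` to the reading in this direction only, and an implication would reverse
  -- it. At a box, `c A` holds because the box is a fact of the chaining; in S4, `reflects` gives
  -- `A` under `w` and the induction hypothesis applies.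
  monotone-reading : ∀ {A} → Monotone A → subformulas A ⊆ subformulas φ → T (eval w A) → T (reading A)
  monotone-reading (mvar a) s h = h
  monotone-reading mtop s h = tt
  monotone-reading (mand {A} {B} m n) s h with T-∧⁻ {eval w A} h
  ... | a , b = T-∧⁺ (monotone-reading m (s ∘ there ∘ ∈-++⁺ˡ) a)
                     (monotone-reading n (s ∘ there ∘ ∈-++⁺ʳ (subformulas A)) b)
  monotone-reading (mor {A} {B} m n) s h with T-∨⁻ {eval w A} h
  ... | inj₁ a = T-∨⁺ (inj₁ (monotone-reading m (s ∘ there ∘ ∈-++⁺ˡ) a))
  ... | inj₂ b = T-∨⁺ {reading A} (inj₂ (monotone-reading n (s ∘ there ∘ ∈-++⁺ʳ (subformulas A)) b))
  monotone-reading (mbox {A} m) s h =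
    boxReading-intro G {φ} {w} reflects (s (there (self∈subformulas A))) h (c-initial (s (here refl)) h)
      (monotone-reading m (s ∘ there))

-- The interpolants and their verification.

implication : List Fm → Fm → Fm
implication [] A = A
implication (B ∷ Γ) A = implication Γ (B ⇒ A)

derive-implication : ∀ {G} Γ {A} → Der G (Γ ⊢ A ∷ []) → Der G ([] ⊢ implication Γ A ∷ [])
derive-implication [] d = d
derive-implication (B ∷ Γ) d = derive-implication Γ (rule₁ (impR B _) d)

eval-implication : ∀ w Γ {A} → T (eval w (implication Γ A)) → All (T ∘ eval w) Γ → T (eval w A)
eval-implication w [] h [] = h
eval-implication w (B ∷ Γ) h (b ∷ hs) = T-⇒⁻ (eval-implication w Γ h hs) b

clauseFm : Clause → Fm
clauseFm (Γ , A) = implication (□* Γ) (□ A)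

module Interpolation {G : System} {φ ψ θ : Fm} (φ-mono : Monotone φ) (u : GProof G (φ ⇒ □ ψ ∨ □ θ)) where

  l = GProof.lines u
  cs = clauses l
  open Chaining φ cs

  interpolant : Fm → Fm
  -- By `closed-final`, this many rounds satisfy every clause under every valuation.
  interpolant = stage (length cs)

  -- Each clause, written as an implication, is a theorem because the conclusion of its inference is
  -- a line of `u`. From these theorems `stage-sound` gives the claim propositionally.
  interpolant⇒□ : ∀ A → Der G ([] ⊢ interpolant A ⇒ □ A ∷ [])
  interpolant⇒□ A = completeness (All.map⁺ (All.tabulate derive-clause)) λ w hs → T-⇒⁺
    (stage-sound w (λ {Γ} m hΓ → eval-implication w (□* Γ) (All.lookup (All.map⁻ hs) m) (All.map⁺ hΓ)) (length cs))
    where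
    derive-clause : ∀ {c} → c ∈ cs → Der G ([] ⊢ clauseFm c ∷ [])
    derive-clause {Γ , A} m = derive-implication (□* Γ) (All.lookup (derivations l) (clause-line l m))

  φ⇒interpolants : Der G ([] ⊢ φ ⇒ interpolant ψ ∨ interpolant θ ∷ [])
  φ⇒interpolants = completeness (derive-reflection G φ) λ w hs → T-⇒⁺ (valid w hs)
    where
    valid : ∀ w → All (T ∘ eval w) (reflection G φ) → T (eval w φ) → T (eval w (interpolant ψ ∨ interpolant θ))
    -- The last line of `u` and the truth of `φ` under the reading make `□ ψ` or `□ θ` true there.
    -- Extracting `c` gives the value of an interpolant under `w`, by the choice of `c`.
    valid w hs h = T-∨⁺ (Sum.map reading-□ reading-□ (T-∨⁻ {reading (□ ψ)} (T-⇒⁻ last-line φ-true)))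
      where
      c : Fm → Bool
      c = value w (length cs)
      open Reading G (λ a → w (var a)) c
      last-line : T (reading (φ ⇒ □ ψ ∨ □ θ))
      last-line = Any.singleton⁻ (All.lookup (lines-true l (λ a → w (var a)) c (closed-final w)) (here refl) [])
      φ-true : T (reading φ)
      φ-true = monotone-reading G φ w c (value-initial w (length cs)) hs φ-mono id h

  -- The number of rounds and the cost of one round are each at most `psize u`, hence the square.
  -- The `suc` is paid by the outermost implication of the proved formula.
  size-bound : length cs * cost cs + suc (fsize φ) ≤ psize u * psize u + fsize (φ ⇒ □ ψ ∨ □ θ)
  size-bound = +-mono-≤ (*-mono-≤ (≤-trans (length≤cost cs) cost≤) cost≤) (s≤s (m≤m+n (fsize φ) _))
    where
    cost≤ : cost cs ≤ psize u
    cost≤ = ≤-trans (cost-clauses l) (≤-reflexive (sym (psize-totalSize u)))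

  interpolant-circuit : ∀ A →
    Σ Circuit λ C → ⟦ C ⟧ ≡ interpolant A × csize C ≤ psize u * psize u + fsize (φ ⇒ □ ψ ∨ □ θ)
  interpolant-circuit A with circuit-stage φ-mono (length cs) A
  ... | C , eq , le = C , eq , ≤-trans le size-bound

  isMDI : IsMDI G φ ψ θ (interpolant ψ) (interpolant θ)
  isMDI = (λ a → atoms-stage (length cs) ψ) , (λ a → atoms-stage (length cs) θ) ,
          theorem φ⇒interpolants , theorem (interpolant⇒□ ψ) , theorem (interpolant⇒□ θ)

theorem7p16 : (G : System) → Σ Poly2 λ p →
    ∀ φ ψ θ → Monotone φ → (u : GProof G (φ ⇒ □ ψ ∨ □ θ)) →
    Σ Circuit λ C → Σ Circuit λ D →
    csize C ≤ eval2 p (psize u) (fsize (φ ⇒ □ ψ ∨ □ θ)) ×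
    csize D ≤ eval2 p (psize u) (fsize (φ ⇒ □ ψ ∨ □ θ)) ×
    IsMDI G φ ψ θ ⟦ C ⟧ ⟦ D ⟧
theorem7p16 G = (X ⊗ X) ⊕ Y , λ φ ψ θ m u →
  let open Interpolation m u
      (C , C≡ , C≤) = interpolant-circuit ψ
      (D , D≡ , D≤) = interpolant-circuit θ
  in C , D , C≤ , D≤ , subst₂ (IsMDI G φ ψ θ) (sym C≡) (sym D≡) isMDI
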